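{- Let $T$ be a countably infinite tournament. Then either $T$ has a quasi-kernel, or there exist vertices $x,y\in V(T)$ such that $V(T)=\Gamma^-(x)\cup\Gamma^+(y)$.
   Context: A tournament is a digraph in which every pair of distinct vertices is joined by exactly one directed edge. $\Gamma^+(v)$ and $\Gamma^-(v)$ denote the sets of out-neighbours and in-neighbours of $v$; for a vertex set $V'$, $\Gamma^+(V')$ is the union of the out-neighbourhoods of its vertices and $\Gamma^+_2(V')=V'\cup\Gamma^+(V')\cup\Gamma^+(\Gamma^+(V'))$. A quasi-kernel is an independent set $Q$ with $\Gamma^+_2(Q)=V(T)$. -}

module Defs where

open import Data.Product using (_×_; ∃)
open import Data.Sum using (_⊎_)
open import Level using (0ℓ)
open import Relation.Binary using (Rel)
open import Relation.Binary.PropositionalEquality using (_≢_)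
open import Relation.Nullary using (¬_)
open import Relation.Unary using (Pred; _∈_; _∪_; _≐_; U)

record Digraph : Set₁ where
  field
    Vertex   : Set
    _⟶_      : Rel Vertex 0ℓ
    loopless : ∀ {v} → ¬ (v ⟶ v)

  VertexSet : Set₁
  VertexSet = Pred Vertex 0ℓ

  Γ⁺ Γ⁻ : Vertex → VertexSet
  Γ⁺ v u = v ⟶ u
  Γ⁻ v u = u ⟶ v

  Γ⁺[_] : VertexSet → VertexSet
  Γ⁺[ S ] u = ∃ λ v → v ∈ S × u ∈ Γ⁺ v

  Γ₂⁺[_] : VertexSet → VertexSet
  Γ₂⁺[ S ] = S ∪ Γ⁺[ S ] ∪ Γ⁺[ Γ⁺[ S ] ]

  Independent : VertexSet → Set
  Independent S = ∀ {u v} → u ∈ S → v ∈ S → ¬ (u ⟶ v)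

  IsQuasiKernel : VertexSet → Set
  IsQuasiKernel Q = Independent Q × Γ₂⁺[ Q ] ≐ U

  HasQuasiKernel : Set₁
  HasQuasiKernel = ∃ λ (Q : VertexSet) → IsQuasiKernel Q

record Tournament : Set₁ where
  field
    digraph : Digraph
  open Digraph digraph public
  field
    exactlyOneEdge : ∀ {u v} → u ≢ v →
      (u ⟶ v × ¬ (v ⟶ u)) ⊎ (v ⟶ u × ¬ (u ⟶ v))

{-# OPTIONS --safe #-}

-- If {x} is not a quasi-kernel, some y is not reached from x in at most two
-- steps. Then y ⟶ x, and every w with x ⟶ w satisfies y ⟶ w, since w ⟶ y would
-- give the path x ⟶ w ⟶ y.
module Submission where

open import Axiom.ExcludedMiddle using (ExcludedMiddle)
open import Data.Nat using (ℕ)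
open import Data.Product using (∃; ∃₂; _,_; proj₁)
open import Data.Sum using (_⊎_; inj₁; inj₂; map)
open import Function.Base using (_∘_)
open import Function.Bundles using (_⤖_; module Bijection)
open import Level using (0ℓ)
open import Relation.Binary.PropositionalEquality using (_≡_; _≢_; refl)
open import Relation.Nullary using (¬_; yes; no; contradiction)
open import Relation.Nullary.Decidable using (decidable-stable)
open import Relation.Unary using (U; _∪_; _≐_; _∈_; _∉_; ｛_｝)
open import Defs

-- Fix any vertex `x`; its singleton is the candidate quasi-kernel. If it misses `y`, then `x` and
-- `y` give the cover: a vertex outside `Γ⁻ x` is `x` or an out-neighbour of `x`, and `y` dominates
-- both kinds, since an edge from either into `y` would make `y` reachable within two steps.

module _ (em : ExcludedMiddle 0ℓ) (T : Tournament) where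
  open Tournament T

  connex : ∀ {u v} → u ≢ v → u ⟶ v ⊎ v ⟶ u
  connex = map proj₁ proj₁ ∘ exactlyOneEdge

  unreached⇒cover : ∀ {x y} → y ∉ Γ₂⁺[ ｛ x ｝ ] → U ≐ (Γ⁻ x ∪ Γ⁺ y)
  unreached⇒cover {x} {y} y∉ = (λ {w} _ → cover w) , _
    where
    ¬x⟶y : ¬ (x ⟶ y)
    ¬x⟶y x⟶y = y∉ (inj₂ (inj₁ (x , refl , x⟶y)))

    y⟶x : y ⟶ x
    y⟶x with connex (y∉ ∘ inj₁)
    ... | inj₁ x⟶y = contradiction x⟶y ¬x⟶y
    ... | inj₂ y⟶x = y⟶x

    cover : ∀ w → w ∈ Γ⁻ x ∪ Γ⁺ y
    cover w with em {x ≡ w}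
    -- There are no loops, so `x` itself must be covered by `Γ⁺ y`.
    ... | yes refl = inj₂ y⟶x
    ... | no x≢w with connex x≢w
    ...   | inj₂ w⟶x = inj₁ w⟶x
    -- Here `w` differs from `y`: it is an out-neighbour of `x`, while `y` is not.
    ...   | inj₁ x⟶w with connex {w} {y} (λ { refl → ¬x⟶y x⟶w })
    ...     | inj₁ w⟶y = contradiction (inj₂ (inj₂ (w , (x , refl , x⟶w) , w⟶y))) y∉
    ...     | inj₂ y⟶w = inj₂ y⟶w

  quasiKernel⊎cover : Vertex → HasQuasiKernel ⊎ (∃₂ λ x y → U ≐ (Γ⁻ x ∪ Γ⁺ y))
  quasiKernel⊎cover x with em {∃ λ y → y ∉ Γ₂⁺[ ｛ x ｝ ]}
  ... | yes (y , y∉) = inj₂ (x , y , unreached⇒cover y∉)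
  ... | no ∄y = inj₁ (｛ x ｝ , (λ { refl refl → loopless }) , _ ,
                      λ {v} _ → decidable-stable em λ v∉ → ∄y (v , v∉))

mainTheorem9 : ExcludedMiddle 0ℓ → (T : Tournament) → let open Tournament T in
    Vertex ⤖ ℕ →
    HasQuasiKernel ⊎ (∃₂ λ x y → U ≐ (Γ⁻ x ∪ Γ⁺ y))
-- The preimage of 0 serves as the starting vertex.
mainTheorem9 em T f = quasiKernel⊎cover em T (proj₁ (Bijection.strictlySurjective f 0))
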